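{- For every positive integer $n$, with $X=[3;n]=3+\tfrac1n=\tfrac{3n+1}{n}$, one has $$\mathrm{F}([3;n])=L_{n+1},$$ where $L_{n+1}$ is the $(n+1)$-th Lucas number.
   Context: The conumerator function is the unique map $\mathrm{con}:\mathbb{Q}_{>0}\to\mathbb{Z}_{>0}$ with $\mathrm{con}(1)=1$ and, for all $X\in\mathbb{Q}_{>0}$, $\mathrm{con}(1+X)=\mathrm{con}(X)+\mathrm{con}(1/X)$ and $\mathrm{con}\left(\tfrac{1}{1+X}\right)=\mathrm{con}(X)$. The codenominator function is $\mathrm{F}(X):=\mathrm{con}(1/X)$ for $X\in\mathbb{Q}_{>0}$; equivalently $\mathrm{F}(1)=1$, $\mathrm{F}(1+X)=\mathrm{F}(1/X)$, $\mathrm{F}\left(\tfrac{1}{1+X}\right)=\mathrm{F}(X)+\mathrm{F}(1/X)$. The Lucas numbers are $L_0=2$, $L_1=1$, $L_n=L_{n-1}+L_{n-2}$. -}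

module Defs where

open import Data.Integer as ℤ using (ℤ; +_; +[1+_]; -[1+_])
import Data.Integer.Properties as ℤ
open import Data.Irrelevant using (Irrelevant; [_])
open import Data.Nat as ℕ using (ℕ; zero; suc; compare; less; equal; greater)
import Data.Nat.Coprimality as C
open C using (Coprime)
import Data.Nat.Divisibility as ∣
import Data.Nat.Properties as ℕ
open import Data.Nat.Tactic.RingSolver using (solve-∀)
open import Data.Product using (∃!; _×_; proj₁; proj₂; swap) renaming (_,_ to _,,_)
open import Data.Rational as ℚ using (ℚ; mkℚ; toℚᵘ)
import Data.Rational.Properties as ℚ
import Data.Rational.Unnormalised as ℚᵘ
import Data.Rational.Unnormalised.Properties as ℚᵘ
open import Data.Refinement using (Refinement-syntax; _,_; value)
open import Relation.Binary.PropositionalEquality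

ℚ⁺ : Set
ℚ⁺ = [ x ∈ ℚ ∣ ℚ.Positive x ]

ℤ⁺ : Set
ℤ⁺ = [ z ∈ ℤ ∣ ℤ.Positive z ]

infixl 6 _+⁺_ _+ᶻ_
infix 8 1/⁺_

fromℕ⁺ : (n : ℕ) → .{{ℕ.NonZero n}} → ℚ⁺
fromℕ⁺ n = + n ℚ./ 1 , [ ℚ.normalize-pos n 1 ]

_+⁺_ : ℚ⁺ → ℚ⁺ → ℚ⁺
(x , [ px ]) +⁺ (y , [ py ]) = x ℚ.+ y , [ ℚ.pos+pos⇒pos x {{px}} y {{py}} ]

1/⁺_ : ℚ⁺ → ℚ⁺
1/⁺ (x , [ px ]) =
  (ℚ.1/ x) {{ℚ.pos⇒nonZero x {{px}}}} , [ ℚ.1/pos⇒pos x {{px}} ]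

1⁺ : ℚ⁺
1⁺ = fromℕ⁺ 1

1ᶻ : ℤ⁺
1ᶻ = + 1 , [ _ ]

_+ᶻ_ : ℤ⁺ → ℤ⁺ → ℤ⁺
(x , [ px ]) +ᶻ (y , [ py ]) = x ℤ.+ y , [ pos+pos x y px py ]
  where
  pos+pos : ∀ x y → ℤ.Positive x → ℤ.Positive y → ℤ.Positive (x ℤ.+ y)
  pos+pos +[1+ _ ] +[1+ _ ] _ _ = _

record IsConumerator (con : ℚ⁺ → ℤ⁺) : Set where
  field
    con-1       : con 1⁺ ≡ 1ᶻ
    con-1+X     : ∀ X → con (1⁺ +⁺ X) ≡ con X +ᶻ con (1/⁺ X)
    con-1/[1+X] : ∀ X → con (1/⁺ (1⁺ +⁺ X)) ≡ con X

private

  -- Subtractive Euclid: with enough fuel, the result on p and q is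
  -- (con X , con (1/X)) for X = (p + 1)/(q + 1).
  conPair : (fuel p q : ℕ) → ℤ⁺ × ℤ⁺
  conPair zero    _ _ = 1ᶻ ,, 1ᶻ
  conPair (suc f) p q with compare p q
  ... | equal _     = 1ᶻ ,, 1ᶻ
  ... | less m k    = let (a ,, b) = conPair f k m in a ,, a +ᶻ b
  ... | greater m k = let (a ,, b) = conPair f k m in a +ᶻ b ,, a

  compare-equal : ∀ m → compare m m ≡ equal m
  compare-equal zero = refl
  compare-equal (suc m) rewrite compare-equal m = refl

  compare-less : ∀ m k → compare m (suc (m ℕ.+ k)) ≡ less m k
  compare-less zero    k = refl
  compare-less (suc m) k rewrite compare-less m k = refl

  compare-greater : ∀ m k → compare (suc (m ℕ.+ k)) m ≡ greater m k
  compare-greater zero    k = refl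
  compare-greater (suc m) k rewrite compare-greater m k = refl

  shrinkˡ : ∀ {f} m k → m ℕ.+ suc (m ℕ.+ k) ℕ.< suc f → k ℕ.+ m ℕ.< f
  shrinkˡ m k (ℕ.s≤s le) = ℕ.≤-trans
    (ℕ.s≤s (ℕ.≤-reflexive (ℕ.+-comm k m)))
    (ℕ.≤-trans (ℕ.m≤n+m _ m) le)

  shrinkʳ : ∀ {f} m k → suc (m ℕ.+ k) ℕ.+ m ℕ.< suc f → k ℕ.+ m ℕ.< f
  shrinkʳ {f} m k lt =
    shrinkˡ m k (subst (ℕ._< suc f) (ℕ.+-comm (suc (m ℕ.+ k)) m) lt)

  fuel-irrelevant : ∀ f g p q → p ℕ.+ q ℕ.< f → p ℕ.+ q ℕ.< g →
                    conPair f p q ≡ conPair g p q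
  fuel-irrelevant (suc f) (suc g) p q lf lg with compare p q
  ... | equal _     = refl
  ... | less m k    = cong (λ r → proj₁ r ,, proj₁ r +ᶻ proj₂ r)
                        (fuel-irrelevant f g k m (shrinkˡ m k lf) (shrinkˡ m k lg))
  ... | greater m k = cong (λ r → proj₁ r +ᶻ proj₂ r ,, proj₁ r)
                        (fuel-irrelevant f g k m (shrinkʳ m k lf) (shrinkʳ m k lg))

  conPair-swap : ∀ f p q → conPair f q p ≡ swap (conPair f p q)
  conPair-swap zero    p q = refl
  conPair-swap (suc f) p q with compare p q
  ... | equal m     rewrite compare-equal m     = refl
  ... | less m k    rewrite compare-greater m k = refl
  ... | greater m k rewrite compare-less m k    = refl

  con₀ : ℚ⁺ → ℤ⁺
  con₀ (mkℚ n q _ , _) = let p = ℕ.pred ℤ.∣ n ∣ in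
    proj₁ (conPair (suc (p ℕ.+ q)) p q)

  frac : ∀ p q → .(Coprime (suc p) (suc q)) → ℚ⁺
  frac p q c = mkℚ +[1+ p ] q c , [ _ ]

  coprime-1+ : ∀ k m → Coprime (suc k) (suc m) →
               Coprime (suc (suc (m ℕ.+ k))) (suc m)
  coprime-1+ k m c = subst (λ n → Coprime n (suc m))
    (cong suc (ℕ.+-suc m k)) (C.coprime-+ {suc k} {suc m} c)

  coprime-1+⁻¹ : ∀ k m → Coprime (suc (suc (m ℕ.+ k))) (suc m) →
                 Coprime (suc k) (suc m)
  coprime-1+⁻¹ k m c {d} (d∣k ,, d∣m) = c
    (subst (d ∣.∣_) (cong suc (ℕ.+-suc m k)) (∣.∣m∣n⇒∣m+n d∣m d∣k) ,, d∣m)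

  value-≡ : {X Y : ℚ⁺} → value X ≡ value Y → X ≡ Y
  value-≡ refl = refl

  1+frac : ∀ k m .(c : Coprime (suc k) (suc m))
    .(c′ : Coprime (suc (suc (m ℕ.+ k))) (suc m)) →
           1⁺ +⁺ frac k m c ≡ frac (suc (m ℕ.+ k)) m c′
  1+frac k m c c′ = value-≡ (ℚ.toℚᵘ-injective (ℚᵘ.≃-trans
    (ℚ.toℚᵘ-homo-+ ℚ.1ℚ (mkℚ +[1+ k ] m c))
    (ℚᵘ.*≡* (cong +_ (nat k m)))))
    where
    nat : ∀ k m → (1 ℕ.* suc m ℕ.+ suc k ℕ.* 1) ℕ.* suc m ≡
                  suc (suc (m ℕ.+ k)) ℕ.* (1 ℕ.* suc m)
    nat = solve-∀

  1/[1+frac] : ∀ k m .(c : Coprime (suc k) (suc m))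
    .(c′ : Coprime (suc m) (suc (suc (m ℕ.+ k)))) →
               1/⁺ (1⁺ +⁺ frac k m c) ≡ frac m (suc (m ℕ.+ k)) c′
  1/[1+frac] k m c c′ = cong 1/⁺_ (1+frac k m c (C.sym c′))

  conPair-fuel : ∀ k m → conPair (suc (m ℕ.+ k) ℕ.+ m) k m ≡
                         conPair (suc (k ℕ.+ m)) k m
  conPair-fuel k m = fuel-irrelevant _ _ k m
    (shrinkʳ m k (ℕ.n<1+n _)) (ℕ.n<1+n _)

  con₀-frac-1+ : ∀ k m .(c : Coprime (suc k) (suc m))
    .(c′ : Coprime (suc (suc (m ℕ.+ k))) (suc m)) →
    con₀ (frac (suc (m ℕ.+ k)) m c′) ≡ con₀ (frac k m c) +ᶻ con₀ (frac m k (C.sym c))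
  con₀-frac-1+ k m c c′
    rewrite compare-greater m k | conPair-fuel k m
    = cong (con₀ (frac k m c) +ᶻ_) (trans
        (cong proj₁ (sym (conPair-swap (suc (k ℕ.+ m)) k m)))
        (cong (λ f → proj₁ (conPair (suc f) m k)) (ℕ.+-comm k m)))

  con₀-frac-1/1+ : ∀ k m .(c : Coprime (suc k) (suc m))
    .(c′ : Coprime (suc m) (suc (suc (m ℕ.+ k)))) →
    con₀ (frac m (suc (m ℕ.+ k)) c′) ≡ con₀ (frac k m c)
  con₀-frac-1/1+ k m c c′
    rewrite compare-less m k | ℕ.+-comm m (suc (m ℕ.+ k)) | conPair-fuel k m = refl

  con₀-isConumerator : IsConumerator con₀
  con₀-isConumerator = record
    { con-1       = refl
    ; con-1+X     = λ
      { (mkℚ +[1+ k ] m c , _) → trans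
          (cong con₀ (1+frac k m c (coprime-1+ k m c)))
          (con₀-frac-1+ k m c (coprime-1+ k m c)) }
    ; con-1/[1+X] = λ
      { (mkℚ +[1+ k ] m c , _) → trans
          (cong con₀ (1/[1+frac] k m c (C.sym (coprime-1+ k m c))))
          (con₀-frac-1/1+ k m c (C.sym (coprime-1+ k m c))) }
    }

  module _ {con con′ : ℚ⁺ → ℤ⁺} (I : IsConumerator con) (J : IsConumerator con′) where
    private
      module I = IsConumerator I
      module J = IsConumerator J

    agree : ∀ f p q .(c : Coprime (suc p) (suc q)) → p ℕ.+ q ℕ.< f →
            con (frac p q c) ≡ con′ (frac p q c)
    agree (suc f) p q c lt with compare p q
    ... | equal m = begin
      con (frac m m c)   ≡⟨ cong con m/m≡1 ⟩
      con 1⁺             ≡⟨ trans I.con-1 (sym J.con-1) ⟩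
      con′ 1⁺            ≡⟨ cong con′ m/m≡1 ⟨
      con′ (frac m m c)  ∎
      where
      open ≡-Reasoning
      m/m≡1 : frac m m c ≡ 1⁺
      m/m≡1 = value-≡ (ℚ.toℚᵘ-injective (ℚᵘ.*≡* (ℤ.*-comm +[1+ m ] (+ 1))))
    ... | less m k = begin
      con (frac m _ c)           ≡⟨ cong con (1/[1+frac] k m d c) ⟨
      con (1/⁺ (1⁺ +⁺ X))        ≡⟨ I.con-1/[1+X] X ⟩
      con X                      ≡⟨ agree f k m d (shrinkˡ m k lt) ⟩
      con′ X                     ≡⟨ J.con-1/[1+X] X ⟨
      con′ (1/⁺ (1⁺ +⁺ X))       ≡⟨ cong con′ (1/[1+frac] k m d c) ⟩
      con′ (frac m _ c)          ∎
      where
      open ≡-Reasoning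
      .d : Coprime (suc k) (suc m)
      d = coprime-1+⁻¹ k m (C.sym (C.recompute c))
      X = frac k m d
    ... | greater m k = begin
      con (frac _ m c)           ≡⟨ cong con (1+frac k m d c) ⟨
      con (1⁺ +⁺ X)              ≡⟨ I.con-1+X X ⟩
      con X +ᶻ con (1/⁺ X)       ≡⟨ cong₂ _+ᶻ_
        (agree f k m d (shrinkʳ m k lt))
        (agree f m k (C.sym d) (subst (ℕ._< f) (ℕ.+-comm k m) (shrinkʳ m k lt))) ⟩
      con′ X +ᶻ con′ (1/⁺ X)     ≡⟨ J.con-1+X X ⟨
      con′ (1⁺ +⁺ X)             ≡⟨ cong con′ (1+frac k m d c) ⟩
      con′ (frac _ m c)          ∎
      where
      open ≡-Reasoning
      .d : Coprime (suc k) (suc m)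
      d = coprime-1+⁻¹ k m (C.recompute c)
      X = frac k m d

    con-unique : ∀ X → con X ≡ con′ X
    con-unique (mkℚ +[1+ p ] q c , _) = agree _ p q c (ℕ.n<1+n _)

conumerator : ∃! _≗_ IsConumerator
conumerator = con₀ ,, con₀-isConumerator ,, con-unique con₀-isConumerator

con : ℚ⁺ → ℤ⁺
con = proj₁ conumerator

con-isConumerator : IsConumerator con
con-isConumerator = proj₁ (proj₂ conumerator)

F : ℚ⁺ → ℤ⁺
F X = con (1/⁺ X)

-- The continued fraction a + 1/b.
[_⨾_] : (a b : ℕ) → .{{ℕ.NonZero a}} → .{{ℕ.NonZero b}} → ℚ⁺
[ a ⨾ b ] = fromℕ⁺ a +⁺ 1/⁺ fromℕ⁺ b

lucas : ℕ → ℕ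
lucas zero          = 2
lucas (suc zero)    = 1
lucas (suc (suc n)) = lucas (suc n) ℕ.+ lucas n

{-# OPTIONS --safe #-}

-- Since F(1 + Y) = con Y, peeling three units off 3 + Y gives
-- F(3 + Y) = con (2 + Y) = 2 con Y + con (1/Y), which for Y = 1/X is
-- G(X) = con X + 2 F(X). Both con and F satisfy f(2 + X) = f(1 + X) + f(X),
-- hence so does G, and G(1) = 3, G(2) = 4 are the Lucas numbers L₂, L₃.
module Submission where

open import Defs
open import Data.Integer using (ℤ; +_; +[1+_]; _+_)
import Data.Integer.Properties as ℤ
open import Data.Integer.Tactic.RingSolver using (solve-∀)
open import Data.Nat using (ℕ; zero; suc; NonZero)
import Data.Nat.Properties as ℕ
open import Data.Rational as ℚ using (mkℚ; 1ℚ)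
import Data.Rational.Properties as ℚ
import Data.Rational.Unnormalised as ℚᵘ
import Data.Rational.Unnormalised.Properties as ℚᵘ
open import Data.Refinement using (value; _,_)
open import Relation.Binary.PropositionalEquality
  using (_≡_; refl; sym; trans; cong; cong₂; module ≡-Reasoning)

open IsConumerator con-isConumerator
open ≡-Reasoning

value-injective : {X Y : ℚ⁺} → value X ≡ value Y → X ≡ Y
value-injective refl = refl

1/⁺-involutive : ∀ X → 1/⁺ 1/⁺ X ≡ X
1/⁺-involutive (mkℚ +[1+ _ ] _ _ , _) = refl

-- `ℚ._/_` divides out a gcd, so the equation is moved to unnormalised fractions, where equality is
-- cross-multiplication.
fromℕ⁺-suc : ∀ n → fromℕ⁺ (suc (suc n)) ≡ 1⁺ +⁺ fromℕ⁺ (suc n)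
fromℕ⁺-suc n = value-injective (ℚ.toℚᵘ-injective (begin-≃
  ℚ.toℚᵘ (+ suc (suc n) ℚ./ 1)
    ≈⟨ ℚ.toℚᵘ-fromℚᵘ (+ suc (suc n) ℚᵘ./ 1) ⟩
  + suc (suc n) ℚᵘ./ 1
    -- The evaluated cross products differ only by a factor 1.
    ≈⟨ ℚᵘ.*≡* (cong (λ m → + suc (suc m)) (sym (ℕ.*-identityʳ _))) ⟩
  ℚᵘ.1ℚᵘ ℚᵘ.+ (+ suc n ℚᵘ./ 1)
    ≈⟨ ℚᵘ.+-congʳ ℚᵘ.1ℚᵘ (ℚ.toℚᵘ-fromℚᵘ (+ suc n ℚᵘ./ 1)) ⟨
  ℚᵘ.1ℚᵘ ℚᵘ.+ ℚ.toℚᵘ (+ suc n ℚ./ 1)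
    ≈⟨ ℚ.toℚᵘ-homo-+ 1ℚ (+ suc n ℚ./ 1) ⟨
  ℚ.toℚᵘ (1ℚ ℚ.+ (+ suc n ℚ./ 1))
    ∎≃))
  where open ℚᵘ.≃-Reasoning using (step-≈-⟩; step-≈-⟨) renaming (begin_ to begin-≃_; _∎ to _∎≃)

-- The closed numeral 3 evaluates to the same rational as `(1ℚ + 1ℚ) + 1ℚ`, so associativity, used
-- twice, is enough.
3+⁺ : ∀ Y → fromℕ⁺ 3 +⁺ Y ≡ 1⁺ +⁺ (1⁺ +⁺ (1⁺ +⁺ Y))
3+⁺ Y = value-injective (trans
  (ℚ.+-assoc (1ℚ ℚ.+ 1ℚ) 1ℚ (value Y))
  (ℚ.+-assoc 1ℚ 1ℚ (1ℚ ℚ.+ value Y)))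

conᶻ Fᶻ G : ℚ⁺ → ℤ
conᶻ X = value (con X)
Fᶻ   X = value (F X)
G    X = conᶻ X + Fᶻ X + Fᶻ X

conᶻ-1+ : ∀ X → conᶻ (1⁺ +⁺ X) ≡ conᶻ X + Fᶻ X
conᶻ-1+ X = cong value (con-1+X X)

Fᶻ-1+ : ∀ X → Fᶻ (1⁺ +⁺ X) ≡ conᶻ X
Fᶻ-1+ X = cong value (con-1/[1+X] X)

F-3+1/ : ∀ X → Fᶻ (fromℕ⁺ 3 +⁺ 1/⁺ X) ≡ G X
F-3+1/ X = begin
  Fᶻ (fromℕ⁺ 3 +⁺ Y)                ≡⟨ cong Fᶻ (3+⁺ Y) ⟩
  Fᶻ (1⁺ +⁺ (1⁺ +⁺ (1⁺ +⁺ Y)))      ≡⟨ Fᶻ-1+ (1⁺ +⁺ (1⁺ +⁺ Y)) ⟩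
  conᶻ (1⁺ +⁺ (1⁺ +⁺ Y))            ≡⟨ conᶻ-1+ (1⁺ +⁺ Y) ⟩
  conᶻ (1⁺ +⁺ Y) + Fᶻ (1⁺ +⁺ Y)     ≡⟨ cong₂ _+_ (conᶻ-1+ Y) (Fᶻ-1+ Y) ⟩
  -- As `Y` is `1/⁺ X`, `conᶻ Y` is `Fᶻ X` by definition, and `Fᶻ Y` unfolds to `conᶻ (1/⁺ Y)`.
  Fᶻ X + conᶻ (1/⁺ Y) + Fᶻ X        ≡⟨ cong (λ Z → Fᶻ X + conᶻ Z + Fᶻ X) (1/⁺-involutive X) ⟩
  Fᶻ X + conᶻ X + Fᶻ X              ≡⟨ cong (_+ Fᶻ X) (ℤ.+-comm (Fᶻ X) (conᶻ X)) ⟩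
  G X                               ∎
  where Y = 1/⁺ X

G-2+ : ∀ X → G (1⁺ +⁺ (1⁺ +⁺ X)) ≡ G (1⁺ +⁺ X) + G X
G-2+ X
  -- Adding 1 takes the pair (con, F) from (a, b) to (a + b, a), then to (2a + b, a + b).
  rewrite conᶻ-1+ (1⁺ +⁺ X) | Fᶻ-1+ (1⁺ +⁺ X) | conᶻ-1+ X | Fᶻ-1+ X
  = identity (conᶻ X) (Fᶻ X)
  where
  identity : ∀ a b → (a + b + a) + (a + b) + (a + b) ≡ (a + b + a + a) + (a + b + b)
  identity = solve-∀

G-fromℕ⁺ : ∀ n → G (fromℕ⁺ (suc n)) ≡ + lucas (suc (suc n))
-- `con` is an explicit subtractive Euclid, so both base values are found by evaluation.
G-fromℕ⁺ zero          = refl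
G-fromℕ⁺ (suc zero)    = refl
G-fromℕ⁺ (suc (suc n)) = begin
  G (fromℕ⁺ (suc (suc (suc n))))      ≡⟨ cong G (fromℕ⁺-suc (suc n)) ⟩
  G (1⁺ +⁺ fromℕ⁺ (suc (suc n)))      ≡⟨ cong (λ Z → G (1⁺ +⁺ Z)) (fromℕ⁺-suc n) ⟩
  G (1⁺ +⁺ (1⁺ +⁺ X))                 ≡⟨ G-2+ X ⟩
  G (1⁺ +⁺ X) + G X                   ≡⟨ cong (λ Z → G Z + G X) (fromℕ⁺-suc n) ⟨
  -- The sum of the two nonnegative integers reduces to the defining clause of `lucas`.
  G (fromℕ⁺ (suc (suc n))) + G X      ≡⟨ cong₂ _+_ (G-fromℕ⁺ (suc n)) (G-fromℕ⁺ n) ⟩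
  + lucas (suc (suc (suc (suc n))))   ∎
  where X = fromℕ⁺ (suc n)

lemma4p3 : (n : ℕ) → .{{_ : NonZero n}} → value (F [ 3 ⨾ n ]) ≡ + lucas (suc n)
lemma4p3 (suc n) = trans (F-3+1/ (fromℕ⁺ (suc n))) (G-fromℕ⁺ n)
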